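{- There exists a connected cubic bipartite graph $G$ such that $\gamma(G)=6$ and $b(G)=5$. Consequently, $b(G)=5>\frac92=\frac32\Delta(G)$, so the assertion "every finite simple graph $H$ with at least one edge satisfies $b(H)\le \frac32\Delta(H)$" (Teschner's conjecture) is false.
   Context: All graphs are finite, simple, and undirected. A graph is cubic if every vertex has degree $3$. $\Delta(G)$ denotes the maximum degree of $G$. A set $D\subseteq V(G)$ is a dominating set of $G$ if every vertex of $V(G)\setminus D$ has a neighbor in $D$. The domination number $\gamma(G)$ is the minimum cardinality of a dominating set of $G$. For $F\subseteq E(G)$, $G-F$ denotes the graph with vertex set $V(G)$ and edge set $E(G)\setminus F$. For a graph $G$ with $E(G)\neq\varnothing$, the bondage number is $b(G)=\min\{|F|: F\subseteq E(G),\ \gamma(G-F)>\gamma(G)\}$. -}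

module Defs where

open import Data.Fin.Base as Fin using (Fin)
import Data.Fin.Properties as Fin
open import Data.Fin.Subset using (Subset; _∈_; _∉_; ∣_∣; _-_; ⊤)
open import Data.Fin.Subset.Properties
  using (_∈?_; ∈⊤; anySubset?; ∣⊤∣≡n; p⊆q⇒∣p∣≤∣q∣; x∈p∧x≢y⇒x∈p-y; x∈p⇒∣p-x∣<∣p∣)
open import Data.Integer.Base using (+_)
open import Data.List.Base using (List; allFin; cartesianProduct; filter; length; lookup; map)
open import Data.List.Extrema.Nat using (max)
open import Data.List.Membership.Propositional.Properties
  using (∈-filter⁺; ∈-cartesianProduct⁺; ∈-allFin)
open import Data.List.Relation.Unary.Any using (index)
open import Data.List.Relation.Unary.Any.Properties using (lookup-index)
open import Data.Nat.Base using (ℕ; zero; suc; _≤_; _<_; _>_; z≤n; s≤s)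
open import Data.Nat.Properties using (_≟_; _<?_; ≤-<-trans; <-≤-trans; ≤-reflexive)
open import Data.Product.Base using (∃; ∃₂; _×_; _,_; proj₁; proj₂)
open import Data.Product.Properties using (≡-dec)
open import Data.Rational.Base as ℚ using (ℚ; _/_)
open import Data.Sum.Base using (_⊎_; inj₁; inj₂; swap)
open import Level using (0ℓ)
open import Function.Base using (_∘_)
open import Relation.Binary.Core using (Rel)
import Relation.Binary.Definitions as Binary
open import Relation.Binary.Construct.Closure.ReflexiveTransitive using (Star)
open import Relation.Binary.PropositionalEquality
  using (_≡_; refl; sym; subst)
open import Relation.Nullary.Decidable using (yes; no; _×-dec_; _⊎-dec_; _→-dec_; ¬?)
open import Relation.Nullary.Negation using (¬_; contradiction)
import Relation.Unary as Unary

Least : (ℕ → Set) → ℕ → Set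
Least P k = P k × (∀ j → P j → k ≤ j)

-- Opaque so that minima over large finite families are never evaluated by
-- search: the type already determines the number.
opaque
  least : {P : ℕ → Set} → Unary.Decidable P → ∃ P → ∃ (Least P)
  least {P} P? (w , Pw) = search P? w Pw
    where
    search : {P : ℕ → Set} → Unary.Decidable P → ∀ w → P w → ∃ (Least P)
    search P? zero    Pw = zero , Pw , λ _ _ → z≤n
    search P? (suc w) Pw with P? zero
    ... | yes P0 = zero , P0 , λ _ _ → z≤n
    ... | no ¬P0 with search (P? ∘ suc) w Pw
    ...   | k , Pk , min = suc k , Pk , λ
            { zero    P0 → contradiction P0 ¬P0
            ; (suc j) Pj → s≤s (min j Pj) }

record Graph : Set₁ where
  field
    order       : ℕ
    Adj         : Rel (Fin order) 0ℓ
    adj?        : Binary.Decidable Adj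
    symmetric   : Binary.Symmetric Adj
    irreflexive : ∀ {v} → ¬ Adj v v

  Vertex : Set
  Vertex = Fin order

  IsEdge : Vertex × Vertex → Set
  IsEdge (u , v) = u Fin.< v × Adj u v

  isEdge? : Unary.Decidable IsEdge
  isEdge? (u , v) = (u Fin.<? v) ×-dec adj? u v

  -- Each undirected edge occurs exactly once, with its smaller endpoint first.
  edges : List (Vertex × Vertex)
  edges = filter isEdge? (cartesianProduct (allFin order) (allFin order))

  EdgeSet : Set
  EdgeSet = Subset (length edges)

  Contains : EdgeSet → Rel Vertex 0ℓ
  Contains F u v = ∃ λ i → i ∈ F × (lookup edges i ≡ (u , v) ⊎ lookup edges i ≡ (v , u))

  contains? : ∀ F → Binary.Decidable (Contains F)
  contains? F u v = Fin.any? λ i →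
    (i ∈? F) ×-dec ((lookup edges i ≟ₑ (u , v)) ⊎-dec (lookup edges i ≟ₑ (v , u)))
    where _≟ₑ_ = ≡-dec Fin._≟_ Fin._≟_

  degree : Vertex → ℕ
  degree v = length (filter (adj? v) (allFin order))

  HasEdge : Set
  HasEdge = ∃₂ Adj

  Cubic : Set
  Cubic = ∀ v → degree v ≡ 3

  Connected : Set
  Connected = ∀ u v → Star Adj u v

  Bipartite : Set
  Bipartite = ∃ λ (A : Subset order) →
    ∀ {u v} → Adj u v → (u ∈ A × v ∉ A) ⊎ (u ∉ A × v ∈ A)

  Dominating : Subset order → Set
  Dominating D = ∀ v → v ∉ D → ∃ λ u → u ∈ D × Adj v u

  dominating? : Unary.Decidable Dominating
  dominating? D = Fin.all? λ v →
    ¬? (v ∈? D) →-dec Fin.any? λ u → (u ∈? D) ×-dec adj? v u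

open Graph public using
  (order; Adj; EdgeSet; degree; HasEdge; Cubic; Connected; Bipartite; Dominating)

infixl 6 _∖_

_∖_ : (G : Graph) → EdgeSet G → Graph
G ∖ F = record
  { order       = order G
  ; Adj         = λ u v → Adj G u v × ¬ Contains F u v
  ; adj?        = λ u v → adj? u v ×-dec ¬? (contains? F u v)
  ; symmetric   = λ { (uv , kept) → symmetric uv , λ { (i , i∈F , e) → kept (i , i∈F , swap e) } }
  ; irreflexive = irreflexive ∘ proj₁
  }
  where open Graph G using (Contains; contains?; adj?; symmetric; irreflexive)

-- The maximum of the empty family of degrees is 0.
Δ : Graph → ℕ
Δ G = max 0 (map (degree G) (allFin (order G)))

DominatedBy : Graph → ℕ → Set
DominatedBy G k = ∃ λ D → Dominating G D × ∣ D ∣ ≡ k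

leastDominating : ∀ G → ∃ (Least (DominatedBy G))
leastDominating G = least
  (λ k → anySubset? λ D → Graph.dominating? G D ×-dec (∣ D ∣ ≟ k))
  (_ , ⊤ , (λ v v∉⊤ → contradiction ∈⊤ v∉⊤) , refl)

γ : Graph → ℕ
γ G = proj₁ (leastDominating G)

BondedBy : Graph → ℕ → Set
BondedBy G k = ∃ λ (F : EdgeSet G) → ∣ F ∣ ≡ k × γ (G ∖ F) > γ G

γ<order : ∀ G → HasEdge G → γ G < order G
γ<order G (u , w , uw) = ≤-<-trans
  (proj₂ (proj₂ (leastDominating G)) _ (⊤ - u , dominates , refl))
  (<-≤-trans (x∈p⇒∣p-x∣<∣p∣ {x = u} ∈⊤) (≤-reflexive (∣⊤∣≡n (order G))))
  where
  open Graph G using (irreflexive)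

  dominates : Dominating G (⊤ - u)
  dominates v v∉ with v Fin.≟ u
  ... | yes refl = w , x∈p∧x≢y⇒x∈p-y ∈⊤ (λ { refl → irreflexive uw }) , uw
  ... | no v≢u   = contradiction (x∈p∧x≢y⇒x∈p-y ∈⊤ v≢u) v∉

⊤-contains : ∀ G {u v} → Adj G u v → Graph.Contains G ⊤ u v
⊤-contains G {u} {v} uv with Fin.<-cmp u v
... | Binary.tri< u<v _ _ = index here , ∈⊤ , inj₁ (sym (lookup-index here))
  where here = ∈-filter⁺ (Graph.isEdge? G)
                 (∈-cartesianProduct⁺ (∈-allFin u) (∈-allFin v)) (u<v , uv)
... | Binary.tri≈ _ refl _ = contradiction uv (Graph.irreflexive G)
... | Binary.tri> _ _ v<u = index here , ∈⊤ , inj₂ (sym (lookup-index here))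
  where here = ∈-filter⁺ (Graph.isEdge? G)
                 (∈-cartesianProduct⁺ (∈-allFin v) (∈-allFin u)) (v<u , Graph.symmetric G uv)

order≤γ[G∖⊤] : ∀ G → order G ≤ γ (G ∖ ⊤)
order≤γ[G∖⊤] G with leastDominating (G ∖ ⊤)
... | k , (D , dom , refl) , _ =
  subst (_≤ ∣ D ∣) (∣⊤∣≡n (order G)) (p⊆q⇒∣p∣≤∣q∣ {p = ⊤} λ {v} _ → everything v)
  where
  everything : ∀ v → v ∈ D
  everything v with v ∈? D
  ... | yes v∈D = v∈D
  ... | no  v∉D with dom v v∉D
  ...   | _ , _ , vu , kept = contradiction (⊤-contains G vu) kept

leastBonding : ∀ G → HasEdge G → ∃ (Least (BondedBy G))
leastBonding G e = least
  (λ k → anySubset? λ F → (∣ F ∣ ≟ k) ×-dec (γ G <? γ (G ∖ F)))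
  (_ , ⊤ , refl , <-≤-trans (γ<order G e) (order≤γ[G∖⊤] G))

bondage : (G : Graph) → HasEdge G → ℕ
bondage G e = proj₁ (leastBonding G e)

fromℕ : ℕ → ℚ
fromℕ n = + n / 1

TeschnerConjecture : Set₁
TeschnerConjecture = ∀ (H : Graph) (e : HasEdge H) →
  fromℕ (bondage H e) ℚ.≤ (+ 3 / 2) ℚ.* fromℕ (Δ H)

{-# OPTIONS --safe #-}
-- G is the cubic graph with LCF code [−7,3,−5,5,−3,7]³: an 18-cycle with nine
-- chords.  Deleting the five edges that meet a fixed edge uv isolates u and v, and
-- a dominating set of the remaining graph dominates G even after v is dropped from
-- it; hence b(G) ≤ 5.  The bounds γ(G) ≥ 6 and b(G) ≥ 5 are instances of one
-- question: can b true atoms satisfy a given monotone formula?  For γ the atoms are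
-- vertices and the formula says that every closed neighbourhood is hit.  For b the
-- atoms are edges and the formula says that, for each D in a certain family of
-- dominating 6-sets, all edges from some vertex outside D to D are deleted.  A
-- branching search of depth at most b refutes both formulas.
module Submission where

open import Defs
open import Data.Bool.Base using (Bool; true; false; T; _∧_)
open import Data.Bool.Properties using (T-∧; T-≡)
open import Data.Fin.Base as Fin using (Fin; zero; suc; inject₁; toℕ)
open import Data.Fin.Induction using (<-weakInduction)
import Data.Fin.Properties as Fin
open import Data.Fin.Subset using (Subset; _∈_; _∉_; ∣_∣; _-_)
open import Data.Fin.Subset.Properties using (_∈?_; x∈p∧x≢y⇒x∈p-y; x∈p⇒∣p-x∣<∣p∣)
open import Data.Integer.Base using (+_)
open import Data.List.Base
  using (List; []; _∷_; allFin; cartesianProduct; concatMap; filter; lookup; map)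
open import Data.List.Membership.Propositional using (find; lose)
  renaming (_∈_ to _∈ˡ_)
open import Data.List.Membership.Propositional.Properties
  using (∈-allFin; ∈-filter⁺; ∈-filter⁻; ∈-lookup)
import Data.List.Membership.DecPropositional as DecMembership
open import Data.List.Relation.Unary.All as All using (All; []; _∷_)
import Data.List.Relation.Unary.All.Properties as All
open import Data.List.Relation.Unary.Any as Any using (Any; here; there)
import Data.List.Relation.Unary.Any.Properties as Any
open import Data.Nat.Base as ℕ using (ℕ; zero; suc; _≤_; _<_; _%_)
open import Data.Nat.DivMod using (_mod_)
import Data.Nat.Properties as ℕ
open import Data.Product.Base using (∃; _×_; _,_; proj₁; proj₂)
open import Data.Product.Properties using (≡-dec)
open import Data.Rational.Base using (_/_; _>_; _*_)
import Data.Rational.Base as ℚ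
import Data.Rational.Properties as ℚ
open import Data.Sum.Base using (_⊎_; inj₁; inj₂)
open import Data.Vec.Base as Vec using (Vec; []; _∷_)
import Data.Vec.Properties as Vec
open import Function.Base using (_∘_; id)
open import Function.Bundles using (Equivalence)
open import Relation.Binary.Construct.Closure.ReflexiveTransitive using (Star; ε; _◅_; _◅◅_; reverse)
open import Relation.Binary.Definitions using (DecidableEquality)
open import Relation.Binary.PropositionalEquality
  using (_≡_; _≢_; refl; sym; trans; cong; subst)
open import Relation.Nullary.Decidable
  using (Dec; yes; no; does; toWitness; _×-dec_; _⊎-dec_; _→-dec_; ¬?; decidable-stable; dec-true)
open import Relation.Nullary.Negation using (¬_; contradiction)
import Relation.Unary as Unary

subsetOf : ∀ {n} {P : Fin n → Set} → Unary.Decidable P → Subset n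
subsetOf P? = Vec.tabulate (does ∘ P?)

∈-subsetOf⁺ : ∀ {n} {P : Fin n → Set} (P? : Unary.Decidable P) {x} → P x → x ∈ subsetOf P?
∈-subsetOf⁺ P? {x} Px = Vec.lookup⇒[]= x _
  (trans (Vec.lookup∘tabulate (does ∘ P?) x) (dec-true (P? x) Px))

-- Bounded search for satisfying assignments of monotone formulas.

module BoundedSearch {E : Set} (_≟_ : DecidableEquality E) where

  -- A formula is a conjunction of clauses, a clause a disjunction of terms, and a
  -- term a conjunction of atoms.
  Term Clause Formula : Set
  Term    = List E
  Clause  = List Term
  Formula = List Clause

  Satisfies : (E → Set) → Formula → Set
  Satisfies P = All (Any (All P))

  others? : (e : E) → Unary.Decidable (_≢ e)
  others? e x = ¬? (x ≟ e)

  undecided? : Unary.Decidable (λ (c : Clause) → ¬ Any (_≡ []) c)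
  undecided? c = ¬? (Any.any? null? c)
    where
    null? : Unary.Decidable (λ (t : Term) → t ≡ [])
    null? []      = yes refl
    null? (_ ∷ _) = no λ ()

  -- A clause with an empty term has become true, so it is dropped.
  assign : E → Formula → Formula
  assign e φ = filter undecided? (map (map (filter (others? e))) φ)

  -- The value false only means that the search found no refutation.
  mutual
    unsatisfiable : ℕ → Formula → Bool
    unsatisfiable b []      = false
    -- The clause stays in the formula: `assign` drops it once all atoms of a chosen term are
    -- assigned.
    unsatisfiable b (c ∷ φ) = refutesAll b c (c ∷ φ)

    refutesAll : ℕ → Clause → Formula → Bool
    refutesAll b       []            φ = true
    refutesAll b       ([] ∷ c)      φ = false
    -- The budget is spent, so a term that still has an atom cannot be true.
    refutesAll zero    ((e ∷ t) ∷ c) φ = refutesAll zero c φ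
    refutesAll (suc b) ((e ∷ t) ∷ c) φ =
      refutes b (filter (others? e) t) (assign e φ) ∧ refutesAll (suc b) c φ

    refutes : ℕ → Term → Formula → Bool
    refutes b       []      φ = unsatisfiable b φ
    refutes zero    (e ∷ t) φ = true
    refutes (suc b) (e ∷ t) φ = refutes b (filter (others? e) t) (assign e φ)

  module _ {m} (label : Fin m → E) where

    -- The budget counts indices, while formulas speak of atoms; `label` is `id` for vertices and
    -- `lookup edges` for edges.
    Labels : Subset m → E → Set
    Labels F e = ∃ λ i → i ∈ F × label i ≡ e

    Labels-remove : ∀ {F i e} → e ≢ label i → Labels F e → Labels (F - i) e
    Labels-remove e≢ (j , j∈F , refl) = j , x∈p∧x≢y⇒x∈p-y j∈F (e≢ ∘ cong label) , refl

    remove-term : ∀ {F i} {t : Term} →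
      All (Labels F) t → All (Labels (F - i)) (filter (others? (label i)) t)
    remove-term {t = t} Ft = All.zipWith (λ (e≢ , Fe) → Labels-remove e≢ Fe)
      (All.all-filter (others? _) t , All.filter⁺ (others? _) Ft)

    -- `assign` erases the atom `label i` everywhere, and a true atom with another label has an
    -- index other than `i`, which survives in `F - i`.
    remove-formula : ∀ {F i} {φ : Formula} →
      Satisfies (Labels F) φ → Satisfies (Labels (F - i)) (assign (label i) φ)
    remove-formula =
      All.filter⁺ undecided? ∘ All.gmap⁺ (Any.map⁺ ∘ Any.map remove-term)

    shrink : ∀ {F : Subset m} {i b} → i ∈ F → ∣ F ∣ ≤ suc b → ∣ F - i ∣ ≤ b
    shrink i∈F ∣F∣≤ = ℕ.≤-pred (ℕ.≤-trans (x∈p⇒∣p-x∣<∣p∣ i∈F) ∣F∣≤)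

    nonempty : ∀ {F : Subset m} {i} → i ∈ F → ¬ ∣ F ∣ ≤ 0
    nonempty i∈F ∣F∣≤0 = ℕ.n≮0 (ℕ.≤-trans (x∈p⇒∣p-x∣<∣p∣ i∈F) ∣F∣≤0)

    mutual
      -- Some term of the leading clause is true. Its atoms leave `F` one at a time, and each
      -- removal pays for one unit of `b`.
      unsatisfiable-sound : ∀ b φ → T (unsatisfiable b φ) →
        ∀ F → ∣ F ∣ ≤ b → ¬ Satisfies (Labels F) φ
      unsatisfiable-sound b (c ∷ φ) ok F ∣F∣≤b (Fc ∷ Fφ) =
        refutesAll-sound b c (c ∷ φ) ok F ∣F∣≤b Fc (Fc ∷ Fφ)

      refutesAll-sound : ∀ b c φ → T (refutesAll b c φ) →
        ∀ F → ∣ F ∣ ≤ b → Any (All (Labels F)) c → ¬ Satisfies (Labels F) φ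
      refutesAll-sound zero ((_ ∷ _) ∷ c) φ ok F ∣F∣≤b (here ((_ , i∈F , _) ∷ _)) =
        contradiction ∣F∣≤b (nonempty i∈F)
      refutesAll-sound zero ((_ ∷ _) ∷ c) φ ok F ∣F∣≤b (there Fc) =
        refutesAll-sound zero c φ ok F ∣F∣≤b Fc
      refutesAll-sound (suc b) ((_ ∷ t) ∷ c) φ ok F ∣F∣≤b (here ((i , i∈F , refl) ∷ Ft)) =
        refutes-sound b _ _ (proj₁ (Equivalence.to T-∧ ok)) (F - i) (shrink i∈F ∣F∣≤b)
          (remove-term Ft) ∘ remove-formula
      refutesAll-sound (suc b) ((e ∷ t) ∷ c) φ ok F ∣F∣≤b (there Fc) =
        refutesAll-sound (suc b) c φ
          (proj₂ (Equivalence.to (T-∧ {refutes b (filter (others? e) t) (assign e φ)}) ok))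
          F ∣F∣≤b Fc

      refutes-sound : ∀ b t φ → T (refutes b t φ) →
        ∀ F → ∣ F ∣ ≤ b → All (Labels F) t → ¬ Satisfies (Labels F) φ
      refutes-sound b [] φ ok F ∣F∣≤b _ = unsatisfiable-sound b φ ok F ∣F∣≤b
      refutes-sound zero (_ ∷ _) φ ok F ∣F∣≤b ((_ , i∈F , _) ∷ _) =
        contradiction ∣F∣≤b (nonempty i∈F)
      refutes-sound (suc b) (_ ∷ t) φ ok F ∣F∣≤b ((i , i∈F , refl) ∷ Ft) =
        refutes-sound b _ _ ok (F - i) (shrink i∈F ∣F∣≤b) (remove-term Ft) ∘ remove-formula

-- Bounds on domination and bondage numbers of an arbitrary graph.

γ-≤ : ∀ G {D} → Dominating G D → γ G ≤ ∣ D ∣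
γ-≤ G dom = proj₂ (proj₂ (leastDominating G)) _ (_ , dom , refl)

γ-attained : ∀ G → ∃ λ D → Dominating G D × ∣ D ∣ ≡ γ G
γ-attained G = proj₁ (proj₂ (leastDominating G))

module _ (G : Graph) where

  open Graph G using (Vertex; Contains; contains?; adj?; edges; isEdge?; IsEdge)

  bondage-≤ : ∀ e F → γ G < γ (G ∖ F) → bondage G e ≤ ∣ F ∣
  bondage-≤ e F γ< = proj₂ (proj₂ (leastBonding G e)) _ (F , refl , γ<)

  bondage-> : ∀ e b → (∀ F → ∣ F ∣ ≤ b → γ (G ∖ F) ≤ γ G) → b < bondage G e
  bondage-> e b robust with proj₁ (proj₂ (leastBonding G e))
  ... | F , ∣F∣≡ , γ< = ℕ.≰⇒> λ bond≤b →
    ℕ.<⇒≱ γ< (robust F (subst (_≤ b) (sym ∣F∣≡) bond≤b))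

  module Vertices = BoundedSearch (Fin._≟_ {order G})
  module Edges    = BoundedSearch (≡-dec (Fin._≟_ {order G}) (Fin._≟_ {order G}))

  closedNeighbour? : ∀ v → Unary.Decidable (λ u → u ≡ v ⊎ Adj G v u)
  closedNeighbour? v u = (u Fin.≟ v) ⊎-dec adj? v u

  dominationFormula : Vertices.Formula
  dominationFormula =
    map (λ v → map (_∷ []) (filter (closedNeighbour? v) (allFin (order G)))) (allFin (order G))

  dominating-satisfies : ∀ {D} → Dominating G D →
    Vertices.Satisfies (Vertices.Labels id D) dominationFormula
  dominating-satisfies {D} dom = All.map⁺ (All.tabulate λ {v} _ → clause v)
    where
    hit : ∀ {u v} → u ∈ D → u ≡ v ⊎ Adj G v u →
      Any (All (Vertices.Labels id D))
          (map (_∷ []) (filter (closedNeighbour? v) (allFin (order G))))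
    hit {u} {v} u∈D near = Any.map⁺ (lose (∈-filter⁺ (closedNeighbour? v) (∈-allFin u) near)
      ((u , u∈D , refl) ∷ []))

    clause : ∀ v → Any (All (Vertices.Labels id D))
      (map (_∷ []) (filter (closedNeighbour? v) (allFin (order G))))
    clause v with v ∈? D
    ... | yes v∈D = hit v∈D (inj₁ refl)
    ... | no  v∉D with dom v v∉D
    ...   | u , u∈D , vu = hit u∈D (inj₂ vu)

  γ-> : ∀ b → Vertices.unsatisfiable b dominationFormula ≡ true → b < γ G
  γ-> b ok with γ-attained G
  ... | D , dom , ∣D∣≡γ = subst (b <_) ∣D∣≡γ (ℕ.≰⇒> λ ∣D∣≤b →
    Vertices.unsatisfiable-sound id b _ (Equivalence.from T-≡ ok) D ∣D∣≤b (dominating-satisfies dom))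

  -- Atoms must match the entries of `edges`, which put the smaller endpoint first.
  ordered : Vertex → Vertex → Vertex × Vertex
  ordered u v with u Fin.<? v
  ... | yes _ = u , v
  ... | no  _ = v , u

  lookup-isEdge : ∀ i → IsEdge (lookup edges i)
  lookup-isEdge i = proj₂ (∈-filter⁻ isEdge? {xs = cartesianProduct (allFin (order G)) (allFin (order G))} (∈-lookup {xs = edges} i))

  contains-ordered : ∀ {F u v} → Contains F u v → Edges.Labels (lookup edges) F (ordered u v)
  contains-ordered {u = u} {v} (i , i∈F , eq) with u Fin.<? v | lookup-isEdge i
  contains-ordered (i , i∈F , inj₁ eq) | yes u<v | _ = i , i∈F , eq
  contains-ordered (i , i∈F , inj₁ eq) | no  u≮v | e =
    contradiction (proj₁ (subst IsEdge eq e)) u≮v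
  contains-ordered (i , i∈F , inj₂ eq) | yes u<v | e =
    contradiction (proj₁ (subst IsEdge eq e)) (Fin.<-asym u<v)
  contains-ordered (i , i∈F , inj₂ eq) | no  u≮v | _ = i , i∈F , eq

  dominator? : ∀ D v → Unary.Decidable (λ u → u ∈ D × Adj G v u)
  dominator? D v u = (u ∈? D) ×-dec adj? v u

  outside? : ∀ D → Unary.Decidable (λ (v : Vertex) → v ∉ D)
  outside? D v = ¬? (v ∈? D)

  spokes : Subset (order G) → Vertex → Edges.Term
  spokes D v = map (ordered v) (filter (dominator? D v) (allFin (order G)))

  destruction : Subset (order G) → Edges.Clause
  destruction D = map (spokes D) (filter (outside? D) (allFin (order G)))

  -- Some vertex outside `D` has lost every edge to `D`, so its whole term of spokes lies in `F`.
  destroyed : ∀ {F D} → ¬ Dominating (G ∖ F) D →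
    Any (All (Edges.Labels (lookup edges) F)) (destruction D)
  destroyed {F} {D} ¬dom
    with Fin.¬∀⟶∃¬ _ _ (λ v → outside? D v →-dec
           Fin.any? λ u → (u ∈? D) ×-dec Graph.adj? (G ∖ F) v u) ¬dom
  ... | v , isolated with v ∈? D
  ...   | yes v∈D = contradiction (contradiction v∈D) isolated
  ...   | no  v∉D = Any.map⁺ (lose (∈-filter⁺ (outside? D) (∈-allFin v) v∉D)
    (All.gmap⁺ deleted (All.all-filter (dominator? D v) (allFin (order G)))))
    where
    deleted : ∀ {u} → u ∈ D × Adj G v u → Edges.Labels (lookup edges) F (ordered v u)
    deleted {u} (u∈D , vu) = contains-ordered {F = F} (decidable-stable (contains? F v u) λ kept →
      isolated λ _ → u , u∈D , vu , kept)

  -- Either a member of `𝓓` still dominates and bounds `γ`, or `F` satisfies every destruction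
  -- clause, which the search excludes.
  robust-γ : ∀ b k (𝓓 : List (Subset (order G))) → All (λ D → ∣ D ∣ ≤ k) 𝓓 →
    Edges.unsatisfiable b (map destruction 𝓓) ≡ true →
    ∀ F → ∣ F ∣ ≤ b → γ (G ∖ F) ≤ k
  robust-γ b k 𝓓 small ok F ∣F∣≤b with Any.any? (Graph.dominating? (G ∖ F)) 𝓓
  ... | no none = contradiction
    (All.gmap⁺ destroyed (All.¬Any⇒All¬ 𝓓 none))
    (Edges.unsatisfiable-sound (lookup edges) b _ (Equivalence.from T-≡ ok) F ∣F∣≤b)
  ... | yes some with find some
  ...   | D , D∈𝓓 , dom = ℕ.≤-trans
    (γ-≤ (G ∖ F) dom) (All.lookup small D∈𝓓)

  Touches : Vertex → Vertex → Vertex × Vertex → Set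
  Touches u v (x , y) = (x ≡ u ⊎ x ≡ v) ⊎ (y ≡ u ⊎ y ≡ v)

  touches? : ∀ u v → Unary.Decidable (Touches u v)
  touches? u v (x , y) =
    ((x Fin.≟ u) ⊎-dec (x Fin.≟ v)) ⊎-dec ((y Fin.≟ u) ⊎-dec (y Fin.≟ v))

  star : Vertex → Vertex → EdgeSet G
  star u v = subsetOf (touches? u v ∘ lookup edges)

  star-contains : ∀ {u v x y} → Adj G x y → x ≡ u ⊎ x ≡ v → Contains (star u v) x y
  star-contains {u} {v} xy x∈uv with ⊤-contains G xy
  ... | i , _ , inj₁ eq = i , ∈-subsetOf⁺ (touches? u v ∘ lookup edges)
    (subst (Touches u v) (sym eq) (inj₁ x∈uv)) , inj₁ eq
  ... | i , _ , inj₂ eq = i , ∈-subsetOf⁺ (touches? u v ∘ lookup edges)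
    (subst (Touches u v) (sym eq) (inj₂ x∈uv)) , inj₂ eq

  -- Both `u` and `v` become isolated and so lie in `D`. In `G` the vertex `u` dominates `v`, and no
  -- other vertex relied on `v`.
  γ-delete-star : ∀ {u v} → Adj G u v → γ G < γ (G ∖ star u v)
  γ-delete-star {u} {v} uv with γ-attained (G ∖ star u v)
  ... | D , dom , ∣D∣≡γ = subst (γ G <_) ∣D∣≡γ
    (ℕ.≤-<-trans (γ-≤ G dominates) (x∈p⇒∣p-x∣<∣p∣ (isolated (inj₂ refl))))
    where
    isolated : ∀ {x} → x ≡ u ⊎ x ≡ v → x ∈ D
    isolated {x} x∈uv with x ∈? D
    ... | yes x∈D = x∈D
    ... | no  x∉D with dom x x∉D
    ...   | _ , _ , xw , kept = contradiction (star-contains xw x∈uv) kept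

    dominates : Dominating G (D - v)
    dominates x x∉ with x Fin.≟ v
    ... | yes refl = u , x∈p∧x≢y⇒x∈p-y (isolated (inj₁ refl)) (λ { refl → Graph.irreflexive G uv })
                       , Graph.symmetric G uv
    ... | no x≢v with dom x (λ x∈D → x∉ (x∈p∧x≢y⇒x∈p-y x∈D x≢v))
    ...   | w , w∈D , xw , kept = w , x∈p∧x≢y⇒x∈p-y w∈D w≢v , xw
      where
      w≢v : w ≢ v
      w≢v refl = Graph.symmetric (G ∖ star u v) (xw , kept) .proj₂
        (star-contains (Graph.symmetric G xw) (inj₂ refl))

-- The counterexample and its structure.

-- The LCF code, with its offsets reduced modulo 18.
chord : ℕ → ℕ
chord k = Vec.lookup (11 ∷ 3 ∷ 13 ∷ 5 ∷ 15 ∷ 7 ∷ []) (k mod 6)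

-- Offsets 1 and 17 are the two directions along the 18-cycle.
neighbours : Fin 18 → List (Fin 18)
neighbours u = map (λ s → (toℕ u ℕ.+ s) mod 18) (1 ∷ 17 ∷ chord (toℕ u) ∷ [])

open DecMembership (Fin._≟_ {18}) using () renaming (_∈?_ to _∈ˡ?_)

adjacent? : ∀ u v → Dec (v ∈ˡ neighbours u)
adjacent? u v = v ∈ˡ? neighbours u

counterexample : Graph
counterexample = record
  { order       = 18
  ; Adj         = λ u v → v ∈ˡ neighbours u
  ; adj?        = adjacent?
  ; symmetric   = λ {u} {v} → toWitness
      {a? = Fin.all? λ u → Fin.all? λ v → adjacent? u v →-dec adjacent? v u} _ u v
  ; irreflexive = λ {v} → toWitness {a? = Fin.all? λ v → ¬? (adjacent? v v)} _ v
  }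

connected : Connected counterexample
connected u v = reverse (λ {x} {y} → Graph.symmetric counterexample {x} {y}) (from0 u) ◅◅ from0 v
  where
  from0 : ∀ v → Star (Adj counterexample) zero v
  from0 = <-weakInduction _ ε λ i path →
    path ◅◅ toWitness {a? = Fin.all? λ i → adjacent? (inject₁ i) (suc i)} _ i ◅ ε

cubic : Cubic counterexample
cubic = toWitness {a? = Fin.all? λ v → degree counterexample v ℕ.≟ 3} _

-- All offsets are odd and 18 is even, so every edge changes parity.
bipartite : Bipartite counterexample
bipartite = evens , λ {u} {v} → toWitness
  {a? = Fin.all? λ u → Fin.all? λ v → adjacent? u v →-dec
    (((u ∈? evens) ×-dec ¬? (v ∈? evens)) ⊎-dec (¬? (u ∈? evens) ×-dec (v ∈? evens)))} _ u v
  where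
  evens : Subset 18
  evens = subsetOf (λ v → toℕ v % 2 ℕ.≟ 0)

-- Found by computer search.
seeds : List (List ℕ)
seeds =
  (0 ∷ 5 ∷ 8 ∷ 10 ∷ 13 ∷ 15 ∷ []) ∷
  (0 ∷ 2 ∷ 5 ∷ 7 ∷ 9 ∷ 13 ∷ []) ∷
  (1 ∷ 3 ∷ 6 ∷ 9 ∷ 12 ∷ 15 ∷ []) ∷
  (0 ∷ 4 ∷ 6 ∷ 9 ∷ 12 ∷ 15 ∷ []) ∷
  (0 ∷ 3 ∷ 6 ∷ 10 ∷ 13 ∷ 14 ∷ []) ∷
  (0 ∷ 2 ∷ 3 ∷ 6 ∷ 10 ∷ 13 ∷ []) ∷
  (1 ∷ 2 ∷ 6 ∷ 9 ∷ 11 ∷ 13 ∷ []) ∷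
  (1 ∷ 2 ∷ 6 ∷ 8 ∷ 10 ∷ 13 ∷ []) ∷ []

-- Over a group of automorphisms, preimages and images give the same orbit; a preimage is tested by
-- evaluating `f`.
preimage : (ℕ → ℕ) → List ℕ → Subset 18
preimage f D = subsetOf λ v → Any.any? (f (toℕ v) % 18 ℕ.≟_) D

-- Rotation by 6 and the reflection v ↦ 17 − v are automorphisms of the graph.
images : List ℕ → List (Subset 18)
images D = concatMap
  (λ r → preimage (λ v → v ℕ.+ r) D ∷ preimage (λ v → 17 ℕ.∸ v ℕ.+ r) D ∷ []) (0 ∷ 6 ∷ 12 ∷ [])

minimumSets : List (Subset 18)
minimumSets = concatMap images seeds

-- Values of the invariants and the refutation.

γ≡6 : γ counterexample ≡ 6
γ≡6 = ℕ.≤-antisym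
  (γ-≤ counterexample {preimage id (1 ∷ 3 ∷ 6 ∷ 9 ∷ 12 ∷ 15 ∷ [])}
    (toWitness {a? = Graph.dominating? counterexample _} _))
  -- Five closed neighbourhoods of size 4 could cover 20 vertices, so counting alone does not
  -- exclude 5; the evaluated search does.
  (γ-> counterexample 5 refl)

hasEdge : HasEdge counterexample
hasEdge = zero , suc zero , here refl

indestructible :
  Edges.unsatisfiable counterexample 4 (map (destruction counterexample) minimumSets) ≡ true
indestructible = refl

bondage≡5 : bondage counterexample hasEdge ≡ 5
bondage≡5 = ℕ.≤-antisym
  -- Three edges meet each of 0 and 1, and they share one: the star has 3 + 3 - 1 = 5 edges.
  (bondage-≤ counterexample hasEdge (star counterexample zero (suc zero))
    (γ-delete-star counterexample {zero} {suc zero} (here refl)))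
  (bondage-> counterexample hasEdge 4 λ F ∣F∣≤4 → subst (γ (counterexample ∖ F) ≤_) (sym γ≡6)
    (robust-γ counterexample 4 6 minimumSets
      (toWitness {a? = All.all? (λ D → ∣ D ∣ ℕ.≤? 6) minimumSets} _)
      indestructible F ∣F∣≤4))

Δ≡3 : Δ counterexample ≡ 3
Δ≡3 = refl

exceeds : fromℕ (bondage counterexample hasEdge) > + 9 / 2
-- `least` is opaque, so the comparison is decided at 5 and transported.
exceeds = subst (λ b → fromℕ b > + 9 / 2) (sym bondage≡5) (toWitness {a? = + 9 / 2 ℚ.<? fromℕ 5} _)

threshold : + 9 / 2 ≡ (+ 3 / 2) * fromℕ (Δ counterexample)
threshold = cong (λ d → (+ 3 / 2) * fromℕ d) (sym Δ≡3)

theorem1p2 : (∃ λ (G : Graph) → Connected G × Cubic G × Bipartite G × γ G ≡ 6 ×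
    (∃ λ (e : HasEdge G) → bondage G e ≡ 5 ×
    fromℕ (bondage G e) > + 9 / 2 × + 9 / 2 ≡ (+ 3 / 2) * fromℕ (Δ G)))
    × ¬ TeschnerConjecture
theorem1p2 =
  (counterexample , connected , cubic , bipartite , γ≡6 , hasEdge , bondage≡5 , exceeds , threshold)
  , λ teschner → ℚ.<-irrefl refl (ℚ.<-≤-trans exceeds
      (subst (fromℕ (bondage counterexample hasEdge) ℚ.≤_) (sym threshold) (teschner counterexample hasEdge)))
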